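{- Let $G$ be a twin-free graph of order $n$ with no isolated vertices. Then $\overset{\rightarrow}{\gamma}_{LD}(G)\leq n/2$.
   Context: All graphs are finite and simple. For an undirected graph $G=(V,E)$ and $S\subseteq V$, $S$ is a locating-dominating set of $G$ if every $u\in V\setminus S$ has $N(u)\cap S\neq\emptyset$ and for all distinct $u,v\in V\setminus S$, $N(u)\cap S\neq N(v)\cap S$. An orientation $D$ of $G$ is obtained by giving each edge exactly one direction. A set $S$ is a locating-dominating set of $D$ if every $u\in V\setminus S$ has $N^-_D(u)\cap S\neq\emptyset$ and for all distinct $u,v\in V\setminus S$, $N^-_D(u)\cap S\neq N^-_D(v)\cap S$ (where $N^-_D(u)$ is the set of in-neighbours of $u$); $\gamma_{LD}(D)$ is the minimum size of such a set. The lower directed location-domination number is $\overset{\rightarrow}{\gamma}_{LD}(G)=\min\{\gamma_{LD}(D): D \text{ an orientation of } G\}$. Two distinct vertices $u,v$ are twins if $N(u)=N(v)$ or $N[u]=N[v]$ (open or closed neighbourhoods); $G$ is twin-free if it has no pair of twins. -}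

module Defs where

open import Data.Nat using (ℕ; _*_; _≤_)
open import Data.Bool using (Bool; true; false; _∨_; _∧_)
open import Data.Fin using (Fin; _≟_)
open import Data.Fin.Subset using (Subset; _∈_; _∉_; ∣_∣)
open import Data.Product using (Σ; _×_; ∃; ∃-syntax)
open import Relation.Nullary using (¬_)
open import Relation.Nullary.Decidable using (⌊_⌋)
open import Relation.Binary.PropositionalEquality using (_≡_; _≢_)

record Graph (n : ℕ) : Set where
  field
    adj   : Fin n → Fin n → Bool
    sym   : ∀ u v → adj u v ≡ adj v u
    irrefl : ∀ u → adj u u ≡ false
open Graph public

closedAdj : ∀ {n} → Graph n → Fin n → Fin n → Bool
closedAdj G u w = ⌊ u ≟ w ⌋ ∨ adj G u w

Twins : ∀ {n} → Graph n → Fin n → Fin n → Set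
Twins G u v = u ≢ v ×
  ((∀ w → adj G u w ≡ adj G v w) Data.Sum.⊎ (∀ w → closedAdj G u w ≡ closedAdj G v w))
  where import Data.Sum

TwinFree : ∀ {n} → Graph n → Set
TwinFree G = ∀ u v → ¬ Twins G u v

NoIsolated : ∀ {n} → Graph n → Set
NoIsolated {n} G = ∀ (u : Fin n) → ∃[ w ] adj G u w ≡ true

-- A digraph on Fin n: arc D u v ≡ true means u → v.
Digraph : ℕ → Set
Digraph n = Fin n → Fin n → Bool

IsOrientation : ∀ {n} → Graph n → Digraph n → Set
IsOrientation G D = ∀ u v → ((D u v ∨ D v u) ≡ adj G u v) × ((D u v ∧ D v u) ≡ false)

-- S is a locating-dominating set of D (using in-neighbourhoods):
-- w ∈ N⁻(u) iff D w u ≡ true.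
IsLocDom : ∀ {n} → Digraph n → Subset n → Set
IsLocDom {n} D S =
  (∀ (u : Fin n) → u ∉ S → ∃[ w ] (w ∈ S × D w u ≡ true)) ×
  (∀ (u v : Fin n) → u ∉ S → v ∉ S → u ≢ v →
     ¬ (∀ w → w ∈ S → D w u ≡ D w v))

{-# OPTIONS --safe #-}

-- Choose a matching with as few unmatched vertices as possible, encoded as an
-- involution f whose fixed points are the unmatched vertices, and let S
-- contain one end of every matched pair, so that 2|S| ≤ n.  Call a matched
-- vertex b spare if some unmatched w is adjacent to f b and to nothing else
-- except possibly b: then b and w compete for the in-neighbourhood {f b}.
-- A spare b can trade places with its w in the matching, so spare vertices
-- behave like unmatched ones; call both kinds exposed.  By the absence of
-- augmenting paths, exposed vertices are almost independent and no pair
-- {x , f x} of unexposed vertices connects two different exposed vertices.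
-- Hence, if S takes from every pair an end with an exposed neighbour whenever
-- there is one, twin-freeness makes the sets N(v) ∩ S distinct and nonempty for
-- exposed v.  Direct all of S towards the exposed vertices, and only f b
-- towards every other b outside S.
module Submission where

open import Defs
open import Data.Nat using (ℕ; _*_; _≤_; suc; zero; _+_; _<_; z≤n; z<s; s<s; _<?_)
open import Data.Nat.Properties
  using ( ≤-antisym; ≤-refl; ≤-reflexive; +-mono-≤; +-mono-<-≤; +-mono-≤-<; +-identityʳ
        ; <⇒≱; ≮⇒≥; <-asym; <-irrefl; <-cmp; +-0-commutativeMonoid; module ≤-Reasoning )
open import Data.Nat.Induction using (<-wellFounded)
open import Data.Bool using (Bool; true; false; _∨_; _∧_; not; if_then_else_)
open import Data.Bool.Properties using (∧-zeroʳ; ∨-inverseʳ; ∧-inverseʳ; ∨-inverseˡ; ∧-inverseˡ; ∧-identityʳ)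
  renaming (_≟_ to _≟ᵇ_)
open import Data.Fin using (Fin; zero; suc; _≟_; toℕ; combine)
open import Data.Fin.Patterns using (0F; 1F; 2F)
open import Data.Fin.Properties using (any?; all?; combine-monoˡ-<; combine-injectiveʳ; toℕ-injective)
import Data.Fin.Permutation as Perm
open import Data.Fin.Permutation.Components using (transpose)
open import Data.Fin.Subset using (Subset; _∈_; ∣_∣)
open import Data.Vec using (Vec; []; _∷_; lookup; tabulate)
open import Data.Vec.Properties using (lookup∘tabulate; lookup⇒[]=)
open import Data.Product using (_×_; _,_; ∃; ∃-syntax; proj₁; proj₂)
open import Data.Sum using (_⊎_; inj₁; inj₂; [_,_]′)
open import Data.Empty using (⊥; ⊥-elim)
open import Function using (_∘_; id)
open import Induction.WellFounded using (Acc; acc)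
open import Relation.Binary using (tri<; tri≈; tri>)
open import Relation.Nullary using (¬_; Dec; yes; no; does; contradiction)
open import Relation.Nullary.Decidable
  using (decidable-stable; map′; dec-true; dec-false; ¬?; _×-dec_; _⊎-dec_; _→-dec_)
open import Relation.Binary.PropositionalEquality
  using (_≡_; _≢_; _≗_; refl; trans; cong; cong₂; subst; ≢-sym)
  renaming (sym to ≡-sym)
open import Algebra.Properties.CommutativeMonoid.Sum +-0-commutativeMonoid
  using (sum; sum-cong-≗; sum-permute; ∑-distrib-+)

private variable
  n m : ℕ
  A : Set

-- Indicators, finite sums and search over vectors.

true≢false : true ≢ false
true≢false ()

𝟙 : Dec A → ℕ
𝟙 a? = if does a? then 1 else 0

𝟙-true : (a? : Dec A) → A → 𝟙 a? ≡ 1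
𝟙-true a? a = cong (if_then 1 else 0) (dec-true a? a)

𝟙-false : (a? : Dec A) → ¬ A → 𝟙 a? ≡ 0
𝟙-false a? ¬a = cong (if_then 1 else 0) (dec-false a? ¬a)

𝟙-mono : {B : Set} (a? : Dec A) (b? : Dec B) → (A → B) → 𝟙 a? ≤ 𝟙 b?
𝟙-mono (no _)  b? f = z≤n
𝟙-mono (yes a) b? f = ≤-reflexive (≡-sym (𝟙-true b? (f a)))

𝟙-disjoint : {B : Set} (a? : Dec A) (b? : Dec B) → (A → ¬ B) → 𝟙 a? + 𝟙 b? ≤ 1
𝟙-disjoint (yes a) (yes b) a⇒¬b = contradiction b (a⇒¬b a)
𝟙-disjoint (yes _) (no _)  _    = ≤-refl
𝟙-disjoint (no _)  (yes _) _    = ≤-refl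
𝟙-disjoint (no _)  (no _)  _    = z≤n

sum-mono-≤ : {s t : Fin n → ℕ} → (∀ i → s i ≤ t i) → sum s ≤ sum t
sum-mono-≤ {zero}  s≤t = z≤n
sum-mono-≤ {suc n} s≤t = +-mono-≤ (s≤t zero) (sum-mono-≤ (s≤t ∘ suc))

sum-mono-< : {s t : Fin n → ℕ} → (∀ i → s i ≤ t i) → ∀ i → s i < t i → sum s < sum t
sum-mono-< s≤t zero    si<ti = +-mono-<-≤ si<ti (sum-mono-≤ (s≤t ∘ suc))
sum-mono-< s≤t (suc i) si<ti = +-mono-≤-< (s≤t zero) (sum-mono-< (s≤t ∘ suc) i si<ti)

sum-ones : ∀ n → sum {n} (λ _ → 1) ≡ n
sum-ones zero    = refl
sum-ones (suc n) = cong suc (sum-ones n)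

∣tabulate∣ : (p : Fin n → Bool) → ∣ tabulate p ∣ ≡ sum (λ i → if p i then 1 else 0)
∣tabulate∣ {zero}  p = refl
∣tabulate∣ {suc n} p with p zero
... | true  = cong suc (∣tabulate∣ (p ∘ suc))
... | false = ∣tabulate∣ (p ∘ suc)

-- Allows an exhaustive search over self-maps of `Fin n` through their tables of values.
anyVec? : {P : Vec (Fin m) n → Set} → (∀ v → Dec (P v)) → Dec (∃ P)
anyVec? {n = zero}  P? = map′ ([] ,_) (λ { ([] , p) → p }) (P? [])
anyVec? {n = suc n} P? = map′ (λ { (x , v , p) → x ∷ v , p }) (λ { (x ∷ v , p) → x , v , p })
                              (any? λ x → anyVec? λ v → P? (x ∷ v))

-- Transpositions.

one-of-or-neither : ∀ (i j k : Fin n) → k ≡ i ⊎ k ≡ j ⊎ (k ≢ i × k ≢ j)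
one-of-or-neither i j k with k ≟ i | k ≟ j
... | yes k≡i | _       = inj₁ k≡i
... | no _    | yes k≡j = inj₂ (inj₁ k≡j)
... | no k≢i  | no k≢j  = inj₂ (inj₂ (k≢i , k≢j))

module _ (i j : Fin n) where

  transpose-left : transpose i j i ≡ j
  transpose-left rewrite dec-true (i ≟ i) refl = refl

  transpose-right : transpose i j j ≡ i
  transpose-right with j ≟ i
  ... | yes j≡i = j≡i
  ... | no _ rewrite dec-true (j ≟ j) refl = refl

  transpose-other : ∀ {k} → k ≢ i → k ≢ j → transpose i j k ≡ k
  transpose-other {k} k≢i k≢j
    rewrite dec-false (k ≟ i) k≢i | dec-false (k ≟ j) k≢j = refl

  transpose-involutive : ∀ k → transpose i j (transpose i j k) ≡ k
  transpose-involutive k with one-of-or-neither i j k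
  ... | inj₁ refl               = trans (cong (transpose i j) transpose-left) transpose-right
  ... | inj₂ (inj₁ refl)        = trans (cong (transpose i j) transpose-right) transpose-left
  ... | inj₂ (inj₂ (k≢i , k≢j)) =
    trans (cong (transpose i j) (transpose-other k≢i k≢j)) (transpose-other k≢i k≢j)

-- Maximum matchings and short augmenting paths.

fixedCount : (Fin n → Fin n) → ℕ
fixedCount f = sum (λ i → 𝟙 (f i ≟ i))

module Matchings (G : Graph n) where

  infix 4 _~_

  _~_ : Fin n → Fin n → Set
  u ~ v = adj G u v ≡ true

  _~?_ : ∀ u v → Dec (u ~ v)
  u ~? v = adj G u v ≟ᵇ true

  ~-sym : ∀ {u v} → u ~ v → v ~ u
  ~-sym {u} {v} = trans (sym G v u)

  ~⇒≢ : ∀ {u v} → u ~ v → u ≢ v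
  ~⇒≢ {u} u~v refl with () ← trans (≡-sym u~v) (irrefl G u)

  Matching : (Fin n → Fin n) → Set
  Matching f = (∀ u → f (f u) ≡ u) × (∀ u → f u ≢ u → u ~ f u)

  matching? : ∀ f → Dec (Matching f)
  matching? f = all? (λ u → f (f u) ≟ u) ×-dec all? (λ u → ¬? (f u ≟ u) →-dec (u ~? f u))

  Maximum : (Fin n → Fin n) → Set
  Maximum f = Matching f × (∀ g → Matching g → fixedCount f ≤ fixedCount g)

  Matching-resp-≗ : ∀ {f g} → f ≗ g → Matching f → Matching g
  Matching-resp-≗ {f} {g} f≗g (invol , matched) =
      (λ u → trans (≡-sym (trans (cong f (f≗g u)) (f≗g (g u)))) (invol u))
    , (λ u gu≢u → subst (u ~_) (f≗g u) (matched u (gu≢u ∘ trans (≡-sym (f≗g u)))))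

  fixedCount-cong : ∀ {f g : Fin n → Fin n} → f ≗ g → fixedCount f ≡ fixedCount g
  fixedCount-cong f≗g = sum-cong-≗ (λ i → cong (λ x → 𝟙 (x ≟ i)) (f≗g i))

  -- Descent: a matching with fewer fixed points replaces `f` until the exhaustive search finds
  -- none.
  maximum-from : ∀ f → Matching f → Acc _<_ (fixedCount f) → ∃ Maximum
  maximum-from f mf (acc rec)
    with anyVec? (λ v → matching? (lookup v) ×-dec (fixedCount (lookup v) <? fixedCount f))
  ... | yes (v , mv , lt) = maximum-from (lookup v) mv (rec lt)
  -- A better `g` would have a table of values with equally few fixed points, which the search has
  -- ruled out.
  ... | no none = f , mf , λ g mg → ≮⇒≥ λ lt → none
    ( tabulate g , Matching-resp-≗ (≡-sym ∘ lookup∘tabulate g) mg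
    , subst (_< fixedCount f) (fixedCount-cong (≡-sym ∘ lookup∘tabulate g)) lt )

  maximum-exists : ∃ Maximum
  maximum-exists =
    maximum-from id ((λ _ → refl) , λ _ u≢u → contradiction refl u≢u) (<-wellFounded _)

  Fixed : (Fin n → Fin n) → Fin n → Set
  Fixed f v = f v ≡ v

  -- `w`, `f b`, `b` is an alternating path from an unmatched vertex, along which the matching can
  -- be shifted.
  Exchangeable : (Fin n → Fin n) → Fin n → Fin n → Set
  Exchangeable f b w = ¬ Fixed f b × Fixed f w × w ~ f b

  fixed≢ : ∀ {f : Fin n → Fin n} {u v} → ¬ Fixed f u → Fixed f v → u ≢ v
  fixed≢ fu≢u fv refl = fu≢u fv

  partner-unfixed : ∀ {f} → Matching f → ∀ {u} → ¬ Fixed f u → ¬ Fixed f (f u)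
  partner-unfixed (invol , _) {u} fu≢u ffu≡fu = fu≢u (trans (≡-sym ffu≡fu) (invol u))

  module _ {f} (mf : Matching f) {y z} (fy : Fixed f y) (fz : Fixed f z) (y~z : y ~ z) where

    private
      τ = transpose y z

      join-off : ∀ {k} → k ≢ y → k ≢ z → f (τ k) ≡ f k
      join-off k≢y k≢z = cong f (transpose-other y z k≢y k≢z)

      join-left : f (τ y) ≡ z
      join-left = trans (cong f (transpose-left y z)) fz

      join-right : f (τ z) ≡ y
      join-right = trans (cong f (transpose-right y z)) fy

      f≢ : ∀ {k v} → Fixed f v → k ≢ v → f k ≢ v
      f≢ {k} fv k≢v fk≡v = k≢v (trans (≡-sym (proj₁ mf k)) (trans (cong f fk≡v) fv))

    -- As `f` fixes both `y` and `z`, composing with their transposition pairs them up and changes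
    -- no other value.
    join-matching : Matching (f ∘ τ)
    join-matching = invol , matched
      where
      invol : ∀ u → f (τ (f (τ u))) ≡ u
      invol u with one-of-or-neither y z u
      ... | inj₁ refl = trans (cong (f ∘ τ) join-left) join-right
      ... | inj₂ (inj₁ refl) = trans (cong (f ∘ τ) join-right) join-left
      ... | inj₂ (inj₂ (u≢y , u≢z)) = trans (cong (f ∘ τ) (join-off u≢y u≢z))
                           (trans (join-off (f≢ fy u≢y) (f≢ fz u≢z)) (proj₁ mf u))
      matched : ∀ u → f (τ u) ≢ u → u ~ f (τ u)
      matched u ne with one-of-or-neither y z u
      ... | inj₁ refl = subst (y ~_) (≡-sym join-left) y~z
      ... | inj₂ (inj₁ refl) = subst (z ~_) (≡-sym join-right) (~-sym y~z)
      ... | inj₂ (inj₂ (u≢y , u≢z)) = subst (u ~_) (≡-sym (join-off u≢y u≢z))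
                           (proj₂ mf u (ne ∘ trans (join-off u≢y u≢z)))

    join-fewer : fixedCount (f ∘ τ) < fixedCount f
    join-fewer = sum-mono-< le y (subst (_< 𝟙 (f y ≟ y))
        (≡-sym (𝟙-false (f (τ y) ≟ y) (λ e → ~⇒≢ y~z (trans (≡-sym e) join-left))))
        (subst (0 <_) (≡-sym (𝟙-true (f y ≟ y) fy)) z<s))
      where
      le : ∀ u → 𝟙 (f (τ u) ≟ u) ≤ 𝟙 (f u ≟ u)
      le u = 𝟙-mono (f (τ u) ≟ u) (f u ≟ u) imp
        where
        imp : f (τ u) ≡ u → f u ≡ u
        imp e with one-of-or-neither y z u
        ... | inj₁ refl = fy
        ... | inj₂ (inj₁ refl) = fz
        ... | inj₂ (inj₂ (u≢y , u≢z)) = trans (≡-sym (join-off u≢y u≢z)) e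

  fixed-independent : ∀ {f y z} → Maximum f → Fixed f y → Fixed f z → ¬ y ~ z
  fixed-independent (mf , best) fy fz y~z =
    <⇒≱ (join-fewer mf fy fz y~z) (best _ (join-matching mf fy fz y~z))

  -- Conjugation by a transposition replaces the pair {b , f b} by {w , f b}.
  swap : Fin n → Fin n → (Fin n → Fin n) → Fin n → Fin n
  swap b w f u = τ (f (τ u)) where τ = transpose b w

  -- A vertex is fixed by the conjugate exactly when its image under the transposition is fixed by
  -- `f`, so the sum is merely reindexed.
  swap-fixedCount : ∀ b w f → fixedCount (swap b w f) ≡ fixedCount f
  swap-fixedCount b w f = trans (sum-cong-≗ conj) (≡-sym (sum-permute (λ i → 𝟙 (f i ≟ i)) (Perm.transpose b w)))
    where
    τ = transpose b w
    conj : ∀ i → 𝟙 (τ (f (τ i)) ≟ i) ≡ 𝟙 (f (τ i) ≟ τ i)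
    conj i = ≤-antisym
      (𝟙-mono (τ (f (τ i)) ≟ i) (f (τ i) ≟ τ i) λ e → trans (≡-sym (transpose-involutive b w (f (τ i)))) (cong τ e))
      (𝟙-mono (f (τ i) ≟ τ i) (τ (f (τ i)) ≟ i) λ e → trans (cong τ e) (transpose-involutive b w i))

  swap-off : ∀ b w f {u} → u ≢ b → u ≢ w → f u ≢ b → f u ≢ w → swap b w f u ≡ f u
  swap-off b w f u≢b u≢w fu≢b fu≢w =
    trans (cong (transpose b w ∘ f) (transpose-other b w u≢b u≢w)) (transpose-other b w fu≢b fu≢w)

  swap-fixes : ∀ b w f → Fixed f w → Fixed (swap b w f) b
  swap-fixes b w f fw =
    trans (cong (transpose b w) (trans (cong f (transpose-left b w)) fw)) (transpose-right b w)

  swap-fixed : ∀ {f b w v} → ¬ Fixed f b → v ≢ w → Fixed f v → Fixed (swap b w f) v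
  swap-fixed {f} {b} {w} fb≢b v≢w fv = trans (swap-off b w f v≢b v≢w
      (v≢b ∘ trans (≡-sym fv)) (v≢w ∘ trans (≡-sym fv))) fv
    where v≢b = ≢-sym (fixed≢ {f = f} fb≢b fv)

  module _ {f b w} (mf : Matching f) (ex : Exchangeable f b w) where
    private
      fb≢b = proj₁ ex
      fw = proj₁ (proj₂ ex)
      w~fb = proj₂ (proj₂ ex)
      τ = transpose b w
      g = swap b w f

      gw : g w ≡ f b
      gw = trans (cong (τ ∘ f) (transpose-right b w))
             (transpose-other b w fb≢b (fixed≢ {f = f} (partner-unfixed mf fb≢b) fw))

      g-partner : g (f b) ≡ w
      g-partner = trans (cong (τ ∘ f) (transpose-other b w fb≢b (fixed≢ {f = f} (partner-unfixed mf fb≢b) fw)))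
                    (trans (cong τ (proj₁ mf b)) (transpose-left b w))

    -- Only the values at `b`, `w` and `f b` change, and the new pair is the edge from `w` to `f b`.
    swap-matching : Matching g
    swap-matching = invol , matched
      where
      invol : ∀ u → g (g u) ≡ u
      invol u = trans (cong (τ ∘ f) (transpose-involutive b w (f (τ u))))
                  (trans (cong τ (proj₁ mf (τ u))) (transpose-involutive b w u))
      matched : ∀ u → g u ≢ u → u ~ g u
      matched u gu≢u with one-of-or-neither b w u
      ... | inj₁ refl = contradiction (swap-fixes b w f fw) gu≢u
      ... | inj₂ (inj₁ refl) = subst (w ~_) (≡-sym gw) w~fb
      ... | inj₂ (inj₂ (u≢b , u≢w)) with u ≟ f b
      ...     | yes refl = subst (f b ~_) (≡-sym g-partner) (~-sym w~fb)
      ...     | no u≢fb  = subst (u ~_) (≡-sym off) (proj₂ mf u (gu≢u ∘ trans off))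
        where
        off : g u ≡ f u
        off = swap-off b w f u≢b u≢w
          (λ fu≡b → u≢fb (trans (≡-sym (proj₁ mf u)) (cong f fu≡b)))
          (λ fu≡w → u≢w (trans (≡-sym (proj₁ mf u)) (trans (cong f fu≡w) fw)))

  swap-maximum : ∀ {f b w} → Maximum f → Exchangeable f b w → Maximum (swap b w f)
  swap-maximum {f} {b} {w} (mf , best) ex = swap-matching mf ex ,
    λ g mg → subst (_≤ fixedCount g) (≡-sym (swap-fixedCount b w f)) (best g mg)

  -- The path `v`, `x`, `f x`, `v′` is augmenting: exchanging `f x` for `v` would leave the adjacent
  -- vertices `f x` and `v′` both unmatched.
  no-aug-fixed-fixed : ∀ {f v v′ x} → Maximum f → Fixed f v → Fixed f v′ → v ≢ v′ →
    v ~ x → f x ~ v′ → ⊥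
  no-aug-fixed-fixed {f} {v} {v′} {x} max@(mf , _) fv fv′ v≢v′ v~x fx~v′ =
    fixed-independent (swap-maximum max ex) (swap-fixes (f x) v f fv)
      (swap-fixed ffx≢fx (≢-sym v≢v′) fv′) fx~v′
    where
    ffx≢fx : ¬ Fixed f (f x)
    ffx≢fx = partner-unfixed mf λ fx → fixed-independent max fv fx v~x
    ex : Exchangeable f (f x) v
    ex = ffx≢fx , fv , subst (v ~_) (≡-sym (proj₁ mf x)) v~x

  Avoids : (Fin n → Fin n) → Fin n → Fin n → Fin n → Set
  Avoids f b w x = x ≢ b × x ≢ w × f x ≢ b × f x ≢ w

  -- The augmenting path is `v`, `x`, `f x`, `b`, `f b`, `w`; the exchange shortens it by making `b`
  -- unmatched.
  no-aug-fixed-swapped : ∀ {f v b w x} → Maximum f → Fixed f v → Exchangeable f b w → v ≢ w →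
    Avoids f b w x → v ~ x → f x ~ b → ⊥
  no-aug-fixed-swapped {f} {v} {b} {w} max fv ex@(fb≢b , fw , _) v≢w (x≢b , x≢w , fx≢b , fx≢w) v~x fx~b =
    no-aug-fixed-fixed (swap-maximum max ex) (swap-fixed fb≢b v≢w fv) (swap-fixes b w f fw)
      (≢-sym (fixed≢ {f = f} fb≢b fv)) v~x (subst (_~ b) (≡-sym (swap-off b w f x≢b x≢w fx≢b fx≢w)) fx~b)

  not-adjacent-fixed-swapped : ∀ {f v b w} → Maximum f → Fixed f v → Exchangeable f b w → v ≢ w → ¬ v ~ b
  not-adjacent-fixed-swapped {f} {v} {b} {w} max fv ex@(fb≢b , fw , _) v≢w =
    fixed-independent (swap-maximum max ex) (swap-fixed fb≢b v≢w fv) (swap-fixes b w f fw)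

  module _ {f b w b′ w′} (max : Maximum f) (ex : Exchangeable f b w) (ex′ : Exchangeable f b′ w′)
           (b≢b′ : b ≢ b′) (w≢w′ : w ≢ w′) (fb′≢b : f b′ ≢ b) where
    private
      g = swap b w f
      fb≢b = proj₁ ex
      fw = proj₁ (proj₂ ex)
      fb′≢b′ = proj₁ ex′
      fw′ = proj₁ (proj₂ ex′)

      b≢w′ : b ≢ w′
      b≢w′ = fixed≢ {f = f} fb≢b fw′

      gb′ : g b′ ≡ f b′
      gb′ = swap-off b w f (≢-sym b≢b′) (fixed≢ {f = f} fb′≢b′ fw) fb′≢b
              (fixed≢ {f = f} (partner-unfixed (proj₁ max) fb′≢b′) fw)

      -- The first exchange keeps the partner of `b′`, so the second is still available after it.
      ex″ : Exchangeable g b′ w′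
      ex″ = fb′≢b′ ∘ trans (≡-sym gb′) , swap-fixed fb≢b (≢-sym w≢w′) fw′
          , subst (w′ ~_) (≡-sym gb′) (proj₂ (proj₂ ex′))

    -- The augmenting path `w`, `f b`, `b`, `x`, `f x`, `b′`, `f b′`, `w′` is shortened from both
    -- ends by the two exchanges.
    no-aug-swapped-swapped : ∀ {x} → Avoids f b w x → Avoids f b′ w′ x → b ~ x → f x ~ b′ → ⊥
    no-aug-swapped-swapped {x} (x≢b , x≢w , fx≢b , fx≢w) (x≢b′ , x≢w′ , fx≢b′ , fx≢w′) b~x fx~b′ =
      no-aug-fixed-swapped (swap-maximum max ex) (swap-fixes b w f fw) ex″ b≢w′
        (x≢b′ , x≢w′ , fx≢b′ ∘ trans (≡-sym gx) , fx≢w′ ∘ trans (≡-sym gx))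
        b~x (subst (_~ b′) (≡-sym gx) fx~b′)
      where
      gx : g x ≡ f x
      gx = swap-off b w f x≢b x≢w fx≢b fx≢w

    not-adjacent-swapped-swapped : ¬ b ~ b′
    not-adjacent-swapped-swapped =
      not-adjacent-fixed-swapped (swap-maximum max ex) (swap-fixes b w f fw) ex″ b≢w′

-- Exposed vertices.

module Construction (G : Graph n) (f : Fin n → Fin n) (max : Matchings.Maximum G f) where

  open Matchings G

  private
    mf : Matching f
    mf = proj₁ max

    ff : ∀ u → f (f u) ≡ u
    ff = proj₁ mf

  f-injective : ∀ {u v} → f u ≡ f v → u ≡ v
  f-injective fu≡fv = trans (≡-sym (ff _)) (trans (cong f fu≡fv) (ff _))

  -- Without the last clause both b and f b would be spare when w ~ b.
  SpareWith : Fin n → Fin n → Set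
  SpareWith b w = Fixed f w × ¬ Fixed f b × w ~ f b
                × (∀ z → w ~ z → z ≡ b ⊎ z ≡ f b) × (w ~ b → toℕ (f b) < toℕ b)

  Exposed : Fin n → Set
  Exposed v = Fixed f v ⊎ ∃ (SpareWith v)

  spareWith? : ∀ b w → Dec (SpareWith b w)
  spareWith? b w = (f w ≟ w) ×-dec ¬? (f b ≟ b) ×-dec (w ~? f b)
    ×-dec all? (λ z → (w ~? z) →-dec ((z ≟ b) ⊎-dec (z ≟ f b)))
    ×-dec ((w ~? b) →-dec (toℕ (f b) <? toℕ b))

  exposed? : ∀ v → Dec (Exposed v)
  exposed? v = (f v ≟ v) ⊎-dec any? (spareWith? v)

  exchangeable : ∀ {b w} → SpareWith b w → Exchangeable f b w
  exchangeable (fw , fb≢b , w~fb , _) = fb≢b , fw , w~fb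

  -- If `w` made both `b` and `f b` spare, the tie-break would order them both ways; a different
  -- `w′` would give the augmenting path `w`, `f b`, `b`, `w′`.
  spare-partner-unexposed : ∀ {b w} → SpareWith b w → ¬ Exposed (f b)
  spare-partner-unexposed (_ , fb≢b , _) (inj₁ ffb≡fb) = partner-unfixed mf fb≢b ffb≡fb
  spare-partner-unexposed {b} {w} (fw , fb≢b , w~fb , _ , tie) (inj₂ (w′ , fw′ , _ , w′~ffb , _ , tie′))
    with w ≟ w′
  ... | yes refl = <-asym (tie (subst (w ~_) (ff b) w′~ffb))
                          (subst (λ z → toℕ z < toℕ (f b)) (ff b) (tie′ w~fb))
  ... | no w≢w′ = no-aug-fixed-fixed max fw fw′ w≢w′ w~fb (~-sym w′~ffb)

  -- The neighbour `f b` of `w` must be `b′` or `f b′`, and the former would make the partner of `b`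
  -- exposed.
  spare-unique : ∀ {b b′ w} → SpareWith b w → SpareWith b′ w → b ≡ b′
  spare-unique sp@(_ , _ , w~fb , _) sp′@(_ , _ , _ , nbrs′ , _) with nbrs′ _ w~fb
  ... | inj₁ fb≡b′  = contradiction (inj₂ (_ , subst (λ u → SpareWith u _) (≡-sym fb≡b′) sp′))
                                    (spare-partner-unexposed sp)
  ... | inj₂ fb≡fb′ = f-injective fb≡fb′

  unexposed-avoids : ∀ {b w x} → SpareWith b w → ¬ Exposed x → ¬ Exposed (f x) → Avoids f b w x
  unexposed-avoids sp ¬x ¬fx =
      (λ { refl → ¬x (inj₂ (_ , sp)) }) , (λ { refl → ¬x (inj₁ (proj₁ sp)) })
    , (λ e → ¬fx (inj₂ (_ , subst (λ u → SpareWith u _) (≡-sym e) sp)))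
    , (λ e → ¬fx (inj₁ (subst (Fixed f) (≡-sym e) (proj₁ sp))))

  private
    no-exposed-path-fixed-spare : ∀ {v b w x} → Fixed f v → SpareWith b w →
      ¬ Exposed x → ¬ Exposed (f x) → v ~ x → f x ~ b → ⊥
    no-exposed-path-fixed-spare {v} {b} {w} {x} fv sp@(fw , _ , w~fb , nbrs , _) ¬x ¬fx v~x fx~b with v ≟ w
    ... | no v≢w = no-aug-fixed-swapped max fv (exchangeable sp) v≢w (unexposed-avoids sp ¬x ¬fx) v~x fx~b
    -- Here `v` has no neighbours besides `b` and `f b`, so one of `x` and `f x` would be the spare
    -- vertex `b`.
    ... | yes refl with nbrs x v~x
    ...   | inj₁ refl = ¬x (inj₂ (_ , sp))
    ...   | inj₂ refl = ¬fx (subst Exposed (≡-sym (ff b)) (inj₂ (_ , sp)))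

  -- Each spare end continues through its partner to an unmatched vertex, which makes the path
  -- augmenting. The two unmatched ends differ because a competitor has so few neighbours.
  no-exposed-path : ∀ {v v′ x} → Exposed v → Exposed v′ → v ≢ v′ →
    ¬ Exposed x → ¬ Exposed (f x) → v ~ x → f x ~ v′ → ⊥
  no-exposed-path (inj₁ fv) (inj₁ fv′) v≢v′ ¬x ¬fx v~x fx~v′ =
    no-aug-fixed-fixed max fv fv′ v≢v′ v~x fx~v′
  no-exposed-path (inj₁ fv) (inj₂ (w , sp)) v≢v′ ¬x ¬fx v~x fx~v′ =
    no-exposed-path-fixed-spare fv sp ¬x ¬fx v~x fx~v′
  no-exposed-path {v} {v′} {x} (inj₂ (w , sp)) (inj₁ fv′) v≢v′ ¬x ¬fx v~x fx~v′ =
    no-exposed-path-fixed-spare fv′ sp ¬fx (¬x ∘ subst Exposed (ff x)) (~-sym fx~v′)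
      (subst (_~ v) (≡-sym (ff x)) (~-sym v~x))
  no-exposed-path {v} {v′} {x} (inj₂ (w , sp)) (inj₂ (w′ , sp′)) v≢v′ ¬x ¬fx v~x fx~v′ =
    no-aug-swapped-swapped max (exchangeable sp) (exchangeable sp′) v≢v′
      (λ { refl → v≢v′ (spare-unique sp sp′) })
      (λ fv′≡v → spare-partner-unexposed sp′ (subst Exposed (≡-sym fv′≡v) (inj₂ (w , sp))))
      (unexposed-avoids sp ¬x ¬fx) (unexposed-avoids sp′ ¬x ¬fx) v~x fx~v′

  -- The same continuations turn any other edge between exposed vertices into an augmenting path.
  exposed-adjacent : ∀ {v v′} → Exposed v → Exposed v′ → v ~ v′ → SpareWith v v′ ⊎ SpareWith v′ v
  exposed-adjacent (inj₁ fv) (inj₁ fv′) v~v′ = contradiction v~v′ (fixed-independent max fv fv′)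
  exposed-adjacent {v} (inj₁ fv) (inj₂ (w , sp)) v~v′ with v ≟ w
  ... | yes refl = inj₂ sp
  ... | no v≢w   = contradiction v~v′ (not-adjacent-fixed-swapped max fv (exchangeable sp) v≢w)
  exposed-adjacent {v} {v′} (inj₂ (w , sp)) (inj₁ fv′) v~v′ with v′ ≟ w
  ... | yes refl = inj₁ sp
  ... | no v′≢w  = contradiction (~-sym v~v′) (not-adjacent-fixed-swapped max fv′ (exchangeable sp) v′≢w)
  exposed-adjacent {v} {v′} (inj₂ (w , sp)) (inj₂ (w′ , sp′)) v~v′ = contradiction v~v′
    (not-adjacent-swapped-swapped max (exchangeable sp) (exchangeable sp′) v≢v′
      (λ { refl → v≢v′ (spare-unique sp sp′) })
      (λ fv′≡v → spare-partner-unexposed sp′ (subst Exposed (≡-sym fv′≡v) (inj₂ (w , sp)))))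
    where v≢v′ = ~⇒≢ v~v′

  -- In the triangle `w`, `b`, `f b` the pair can be traversed the other way, so `w`, `b`, `f b`,
  -- `v` would be, or begin, an augmenting path.
  spare-triangle : ∀ {b w v} → SpareWith b w → w ~ b → Exposed v → v ≢ w → v ≢ b → ¬ f b ~ v
  spare-triangle (fw , _) w~b (inj₁ fv) v≢w v≢b fb~v = no-aug-fixed-fixed max fw fv (≢-sym v≢w) w~b fb~v
  spare-triangle {b} {w} {v} sp@(fw , fb≢b , _) w~b (inj₂ (w′ , sp′)) v≢w v≢b fb~v =
    no-aug-fixed-swapped max fw (exchangeable sp′)
      (λ { refl → v≢b (spare-unique sp′ sp) })
      ( ≢-sym v≢b , fixed≢ {f = f} fb≢b (proj₁ sp′)
      , (λ fb≡v → spare-partner-unexposed sp (subst Exposed (≡-sym fb≡v) (inj₂ (w′ , sp′))))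
      , fixed≢ {f = f} (partner-unfixed mf fb≢b) (proj₁ sp′) )
      w~b fb~v

  -- Choosing one end of every pair.

  Heavy : Fin n → Set
  Heavy u = ∃[ v ] (Exposed v × v ~ u)

  heavy? : ∀ u → Dec (Heavy u)
  heavy? u = any? (λ v → exposed? v ×-dec (v ~? u))

  abstract
    -- Exposed ends rank lowest, to be kept out of `S`; unexposed ends with an exposed neighbour
    -- rank highest.
    priority : Fin n → Fin 3
    priority u with exposed? u | heavy? u
    ... | yes _ | _     = 0F
    ... | no _  | yes _ = 2F
    ... | no _  | no _  = 1F

    priority-exposed : ∀ {u} → Exposed u → priority u ≡ 0F
    priority-exposed {u} eu with exposed? u | heavy? u
    ... | yes _  | _ = refl
    ... | no ¬eu | _ = contradiction eu ¬eu

    priority-unexposed : ∀ {u} → ¬ Exposed u → 0 < toℕ (priority u)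
    priority-unexposed {u} ¬eu with exposed? u | heavy? u
    ... | yes eu | _     = contradiction eu ¬eu
    ... | no _   | yes _ = z<s
    ... | no _   | no _  = z<s

    priority-heavy : ∀ {u} → ¬ Exposed u → Heavy u → priority u ≡ 2F
    priority-heavy {u} ¬eu hu with exposed? u | heavy? u
    ... | yes eu | _     = contradiction eu ¬eu
    ... | no _   | yes _ = refl
    ... | no _   | no ¬hu = contradiction hu ¬hu

    priority-not-heavy : ∀ {u} → ¬ Heavy u → toℕ (priority u) < 2
    priority-not-heavy {u} ¬hu with exposed? u | heavy? u
    ... | yes _ | _      = z<s
    ... | no _  | yes hu = contradiction hu ¬hu
    ... | no _  | no _   = s<s z<s

  -- Lexicographic by priority and then by index, so distinct vertices have distinct keys and every
  -- pair has a winner.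
  key : Fin n → ℕ
  key u = toℕ (combine (priority u) u)

  Selected : Fin n → Set
  Selected u = key (f u) < key u

  selected? : ∀ u → Dec (Selected u)
  selected? u = key (f u) <? key u

  key-mono : ∀ {u v} → toℕ (priority u) < toℕ (priority v) → key u < key v
  key-mono {u} {v} = combine-monoˡ-< {i = priority u} {j = priority v} u v

  selected-partner : ∀ {u} → Selected u → ¬ Selected (f u)
  selected-partner {u} su sfu = <-asym su (subst (λ v → key v < key (f u)) (ff u) sfu)

  select-one : ∀ {u} → ¬ Fixed f u → ¬ Selected u → Selected (f u)
  select-one {u} fu≢u ¬su with <-cmp (key (f u)) (key u)
  ... | tri< lt _ _ = contradiction lt ¬su
  ... | tri≈ _ eq _ = contradiction
          (combine-injectiveʳ (priority (f u)) (f u) (priority u) u (toℕ-injective eq)) fu≢u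
  ... | tri> _ _ gt = subst (λ v → key v < key (f u)) (≡-sym (ff u)) gt

  -- A fixed point would have to beat itself, and a spare vertex loses to its unexposed partner.
  selected-unexposed : ∀ {u} → Selected u → ¬ Exposed u
  selected-unexposed {u} su (inj₁ fu≡u) = <-irrefl (cong key fu≡u) su
  selected-unexposed {u} su eu@(inj₂ (w , sp)) = <-asym su (key-mono {u} {f u}
    (subst (λ p → toℕ p < toℕ (priority (f u))) (≡-sym (priority-exposed eu))
      (priority-unexposed (spare-partner-unexposed sp))))

  spare-partner-selected : ∀ {b w} → SpareWith b w → Selected (f b)
  spare-partner-selected sp =
    select-one (proj₁ (proj₂ sp)) (λ sb → selected-unexposed sb (inj₂ (_ , sp)))

  -- Selected neighbours of exposed vertices.

  data Neighbour (v z : Fin n) : Set where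
    selected   : Selected z → Neighbour v z
    unselected : ¬ Exposed z → ¬ Exposed (f z) → Selected (f z) → v ~ f z → Neighbour v z
    spare      : SpareWith z v → Neighbour v z
    rival      : SpareWith v z → Neighbour v z

  -- Every case supplies a selected neighbour of `v`: `z` itself, its partner `f z`, or, for a rival
  -- `z`, the partner `f v`.
  neighbour : ∀ {v z} → Exposed v → v ~ z → Neighbour v z
  neighbour {v} {z} ev v~z with selected? z | exposed? z
  ... | yes sz | _      = selected sz
  ... | no _   | yes ez with exposed-adjacent ev ez v~z
  ...   | inj₁ sp = rival sp
  ...   | inj₂ sp = spare sp
  neighbour {v} {z} ev v~z | no ¬sz | no ¬ez = unselected ¬ez ¬efz sfz v~fz
    where
    sfz : Selected (f z)
    sfz = select-one (¬ez ∘ inj₁) ¬sz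
    ¬efz : ¬ Exposed (f z)
    ¬efz = selected-unexposed sfz
    -- Otherwise `z`, which has the exposed neighbour `v`, would have been preferred to `f z`.
    hfz : Heavy (f z)
    hfz = decidable-stable (heavy? (f z)) λ ¬h → ¬sz (key-mono {f z} {z}
      (subst (λ p → toℕ (priority (f z)) < toℕ p) (≡-sym (priority-heavy ¬ez (v , ev , v~z)))
        (priority-not-heavy ¬h)))
    -- An exposed neighbour of `f z` other than `v` would be connected to `v` through the pair of
    -- `z`.
    v~fz : v ~ f z
    v~fz with hfz
    ... | v′ , ev′ , v′~fz with v ≟ v′
    ...   | yes refl = v′~fz
    ...   | no v≢v′  = ⊥-elim (no-exposed-path ev ev′ v≢v′ ¬ez ¬efz v~z (~-sym v′~fz))

  selected-neighbour : ∀ {v z} → Exposed v → v ~ z → ∃[ s ] (Selected s × v ~ s)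
  selected-neighbour {v} {z} ev v~z with neighbour ev v~z
  ... | selected sz            = z , sz , v~z
  ... | unselected _ _ sfz v~fz = f z , sfz , v~fz
  ... | spare sp = f z , spare-partner-selected sp , proj₁ (proj₂ (proj₂ sp))
  ... | rival sp = f v , spare-partner-selected sp , proj₂ mf v (proj₁ (proj₂ sp))

  -- If `z` is not selected, a selected partner replaces it; `no-exposed-path` or `spare-triangle`
  -- keeps the replacement from being adjacent to `v′`.
  separating-neighbour : ∀ {v v′ z} → Exposed v → Exposed v′ → v ≢ v′ → v ~ z → ¬ v′ ~ z → z ≢ v′ →
    ∃[ s ] (Selected s × v ~ s × ¬ v′ ~ s)
  separating-neighbour {v} {v′} {z} ev ev′ v≢v′ v~z v′≁z z≢v′ with neighbour ev v~z
  ... | selected sz = z , sz , v~z , v′≁z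
  ... | unselected ¬ez ¬efz sfz v~fz = f z , sfz , v~fz ,
          λ v′~fz → no-exposed-path ev ev′ v≢v′ ¬ez ¬efz v~z (~-sym v′~fz)
  ... | spare sp = f z , spare-partner-selected sp , proj₁ (proj₂ (proj₂ sp)) ,
          λ v′~fz → spare-triangle sp v~z ev′ (≢-sym v≢v′) (≢-sym z≢v′) (~-sym v′~fz)
  ... | rival sp = f v , spare-partner-selected sp , proj₂ mf v (proj₁ (proj₂ sp)) ,
          λ v′~fv → spare-triangle sp (~-sym v~z) ev′ (≢-sym z≢v′) (≢-sym v≢v′) (~-sym v′~fv)

  -- Exposed vertices that no selected vertex tells apart are told apart by no third vertex at all,
  -- so they are closed or open twins according to whether they are adjacent.
  exposed-located : TwinFree G → ∀ {v v′} → Exposed v → Exposed v′ → v ≢ v′ →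
    (∀ s → Selected s → adj G v s ≡ adj G v′ s) → ⊥
  exposed-located twin-free {v} {v′} ev ev′ v≢v′ same = twin-free v v′ (v≢v′ , twins)
    where
    agree : ∀ z → z ≢ v → z ≢ v′ → adj G v z ≡ adj G v′ z
    agree z z≢v z≢v′ with adj G v z in eq | adj G v′ z in eq′
    ... | true  | true  = refl
    ... | false | false = refl
    ... | true  | false with s , ss , v~s , v′≁s ← separating-neighbour ev ev′ v≢v′ eq
                               (λ v′~z → true≢false (trans (≡-sym v′~z) eq′)) z≢v′
                        = contradiction (trans (≡-sym (same s ss)) v~s) v′≁s
    ... | false | true  with s , ss , v′~s , v≁s ← separating-neighbour ev′ ev (≢-sym v≢v′) eq′
                               (λ v~z → true≢false (trans (≡-sym v~z) eq)) z≢v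
                        = contradiction (trans (same s ss) v′~s) v≁s

    twins : (∀ w → adj G v w ≡ adj G v′ w) ⊎ (∀ w → closedAdj G v w ≡ closedAdj G v′ w)
    twins with adj G v v′ in vv′
    ... | false = inj₁ open-twins
      where
      open-twins : ∀ w → adj G v w ≡ adj G v′ w
      open-twins w with one-of-or-neither v v′ w
      ... | inj₁ refl        = trans (irrefl G v) (≡-sym (trans (sym G v′ v) vv′))
      ... | inj₂ (inj₁ refl) = trans vv′ (≡-sym (irrefl G v′))
      ... | inj₂ (inj₂ (w≢v , w≢v′)) = agree w w≢v w≢v′
    ... | true = inj₂ closed-twins
      where
      closed-twins : ∀ w → closedAdj G v w ≡ closedAdj G v′ w
      closed-twins w with v ≟ w | v′ ≟ w
      ... | yes refl | yes _     = refl
      ... | yes refl | no _      = ≡-sym (trans (sym G v′ v) vv′)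
      ... | no _     | yes refl  = vv′
      ... | no v≢w   | no v′≢w   = agree w (≢-sym v≢w) (≢-sym v′≢w)

  -- A spare `v` has the selected neighbour `f v`, which would have to be `f b`. An unmatched `v`
  -- would have all its neighbours in the pair of `b`, making one end of it spare although neither
  -- is exposed.
  exposed-not-single : ∀ {v b} → Exposed v → ¬ Exposed b → Selected (f b) → v ~ f b →
    ¬ (∀ s → Selected s → v ~ s → s ≡ f b)
  exposed-not-single {v} {b} ev@(inj₂ (w , sp)) ¬eb sfb v~fb only =
    ¬eb (subst Exposed (f-injective (only (f v) (spare-partner-selected sp)
      (proj₂ mf v (proj₁ (proj₂ sp))))) ev)
  exposed-not-single {v} {b} ev@(inj₁ fv) ¬eb sfb v~fb only = conclude
    where
    nbrs : ∀ z → v ~ z → z ≡ b ⊎ z ≡ f b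
    nbrs z v~z with neighbour ev v~z
    ... | selected sz             = inj₂ (only z sz v~z)
    ... | unselected _ _ sfz v~fz = inj₁ (f-injective (only (f z) sfz v~fz))
    ... | spare sp = inj₁ (f-injective (only (f z) (spare-partner-selected sp) (proj₁ (proj₂ (proj₂ sp)))))
    ... | rival sp = contradiction fv (proj₁ (proj₂ sp))

    not-spare : ¬ (v ~ b → toℕ (f b) < toℕ b)
    not-spare tie = ¬eb (inj₂ (v , fv , ¬eb ∘ inj₁ , v~fb , nbrs , tie))

    conclude : ⊥
    conclude with v ~? b
    ... | no v≁b = not-spare (λ v~b → contradiction v~b v≁b)
    ... | yes v~b with <-cmp (toℕ (f b)) (toℕ b)
    ...   | tri< fb<b _ _ = not-spare (λ _ → fb<b)
    ...   | tri≈ _ fb≡b _ = ¬eb (inj₁ (toℕ-injective fb≡b))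
    -- The tie-break now makes `f b` the spare end, whereas selected vertices are unexposed.
    ...   | tri> _ _ b<fb = selected-unexposed sfb (inj₂ (v , fv , partner-unfixed mf (¬eb ∘ inj₁)
              , subst (v ~_) (≡-sym (ff b)) v~b
              , (λ z v~z → [ (λ z≡b → inj₂ (trans z≡b (≡-sym (ff b)))) , inj₁ ]′ (nbrs z v~z))
              , (λ _ → subst (λ u → toℕ u < toℕ (f b)) (≡-sym (ff b)) b<fb)))

  -- The orientation and its locating-dominating set.

  towards : Fin n → Fin n → Bool
  towards s v = does (exposed? v ⊎-dec (s ≟ f v))

  directed : Bool → Bool → Fin n → Fin n → Bool
  directed true  false u v = towards u v
  directed false true  u v = not (towards v u)
  -- Location looks only at arcs from `S` into its complement; edges within either side follow the
  -- index order as an arbitrary choice.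
  directed true  true  u v = does (toℕ u <? toℕ v)
  directed false false u v = does (toℕ u <? toℕ v)

  D : Digraph n
  D u v = adj G u v ∧ directed (does (selected? u)) (does (selected? v)) u v

  S : Subset n
  S = tabulate (λ u → does (selected? u))

  selected⇒S : ∀ {u} → Selected u → u ∈ S
  selected⇒S {u} su =
    lookup⇒[]= u S (trans (lookup∘tabulate (does ∘ selected?) u) (dec-true (selected? u) su))

  <?-antisymmetric : ∀ {u v : Fin n} → u ≢ v →
    let p = does (toℕ u <? toℕ v) ; q = does (toℕ v <? toℕ u) in
    (p ∨ q ≡ true) × (p ∧ q ≡ false)
  <?-antisymmetric {u} {v} u≢v with <-cmp (toℕ u) (toℕ v)
  ... | tri< u<v _ v≮u rewrite dec-true (toℕ u <? toℕ v) u<v | dec-false (toℕ v <? toℕ u) v≮u = refl , refl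
  ... | tri≈ _ u≡v _ = contradiction (toℕ-injective u≡v) u≢v
  ... | tri> u≮v _ v<u rewrite dec-false (toℕ u <? toℕ v) u≮v | dec-true (toℕ v <? toℕ u) v<u = refl , refl

  directed-antisymmetric : ∀ a b {u v} → u ≢ v →
    (directed a b u v ∨ directed b a v u ≡ true) × (directed a b u v ∧ directed b a v u ≡ false)
  directed-antisymmetric true  false {u} {v} _   = ∨-inverseʳ (towards u v) , ∧-inverseʳ (towards u v)
  directed-antisymmetric false true  {u} {v} _   = ∨-inverseˡ (towards v u) , ∧-inverseˡ (towards v u)
  directed-antisymmetric true  true          u≢v = <?-antisymmetric u≢v
  directed-antisymmetric false false         u≢v = <?-antisymmetric u≢v

  D-orientation : IsOrientation G D
  D-orientation u v rewrite sym G v u with adj G u v in uv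
  ... | false = refl , refl
  ... | true  = directed-antisymmetric (does (selected? u)) (does (selected? v)) (~⇒≢ uv)

  D-into : ∀ {s v} → Selected s → ¬ Selected v → D s v ≡ adj G s v ∧ towards s v
  D-into {s} {v} ss ¬sv rewrite dec-true (selected? s) ss | dec-false (selected? v) ¬sv = refl

  D-into-exposed : ∀ {s v} → Selected s → Exposed v → D s v ≡ adj G v s
  D-into-exposed {s} {v} ss ev = trans (D-into ss (λ sv → selected-unexposed sv ev))
    (trans (cong (adj G s v ∧_) (dec-true (exposed? v ⊎-dec (s ≟ f v)) (inj₁ ev)))
      (trans (∧-identityʳ _) (sym G s v)))

  D-from-partner : ∀ {v} → ¬ Exposed v → ¬ Selected v → D (f v) v ≡ true
  D-from-partner {v} ¬ev ¬sv = trans (D-into (select-one (¬ev ∘ inj₁) ¬sv) ¬sv)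
    (cong₂ _∧_ (~-sym (proj₂ mf v (¬ev ∘ inj₁))) (dec-true (exposed? v ⊎-dec (f v ≟ f v)) (inj₂ refl)))

  D-only-from-partner : ∀ {s v} → Selected s → ¬ Exposed v → ¬ Selected v → D s v ≡ true → s ≡ f v
  D-only-from-partner {s} {v} ss ¬ev ¬sv Dsv = decidable-stable (s ≟ f v) λ s≢fv →
    true≢false (trans (≡-sym Dsv) (trans (D-into ss ¬sv)
      (trans (cong (adj G s v ∧_) (dec-false (exposed? v ⊎-dec (s ≟ f v)) [ ¬ev , s≢fv ]′)) (∧-zeroʳ _))))

  D-dominated : NoIsolated G → ∀ u → ¬ Selected u → ∃[ w ] (w ∈ S × D w u ≡ true)
  D-dominated no-isolated u ¬su with exposed? u
  ... | no ¬eu = f u , selected⇒S (select-one (¬eu ∘ inj₁) ¬su) , D-from-partner ¬eu ¬su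
  ... | yes eu with s , ss , u~s ← selected-neighbour eu (proj₂ (no-isolated u)) =
    s , selected⇒S ss , trans (D-into-exposed ss eu) u~s

  -- Equal in-neighbourhoods would leave `f b` as the only selected neighbour of `v`, against
  -- `exposed-not-single`.
  exposed-unexposed-located : ∀ {v b} → Exposed v → ¬ Exposed b → ¬ Selected b →
    (∀ s → Selected s → D s v ≡ D s b) → ⊥
  exposed-unexposed-located ev ¬eb ¬sb same = exposed-not-single ev ¬eb sfb
    (trans (≡-sym (D-into-exposed sfb ev)) (trans (same _ sfb) (D-from-partner ¬eb ¬sb)))
    (λ s ss v~s → D-only-from-partner ss ¬eb ¬sb
      (trans (≡-sym (same s ss)) (trans (D-into-exposed ss ev) v~s)))
    where sfb = select-one (¬eb ∘ inj₁) ¬sb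

  D-located : TwinFree G → ∀ u v → ¬ Selected u → ¬ Selected v → u ≢ v →
    ¬ (∀ s → Selected s → D s u ≡ D s v)
  D-located twin-free u v ¬su ¬sv u≢v same with exposed? u | exposed? v
  ... | yes eu | yes ev = exposed-located twin-free eu ev u≢v λ s ss →
          trans (≡-sym (D-into-exposed ss eu)) (trans (same s ss) (D-into-exposed ss ev))
  ... | yes eu | no ¬ev = exposed-unexposed-located eu ¬ev ¬sv same
  ... | no ¬eu | yes ev = exposed-unexposed-located ev ¬eu ¬su (λ s ss → ≡-sym (same s ss))
  -- Two unexposed vertices outside `S` are each dominated by their partner alone, and distinct
  -- vertices have distinct partners.
  ... | no ¬eu | no ¬ev = u≢v (f-injective (D-only-from-partner sfu ¬ev ¬sv
          (trans (≡-sym (same _ sfu)) (D-from-partner ¬eu ¬su))))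
    where sfu = select-one (¬eu ∘ inj₁) ¬su

  D-locDom : TwinFree G → NoIsolated G → IsLocDom D S
  D-locDom twin-free no-isolated =
      (λ u u∉S → D-dominated no-isolated u (u∉S ∘ selected⇒S))
    , (λ u v u∉S v∉S u≢v same → D-located twin-free u v (u∉S ∘ selected⇒S) (v∉S ∘ selected⇒S) u≢v
        (λ s ss → same s (selected⇒S ss)))

  -- Reindexing along the involution `f` counts `S` a second time through partners, and no vertex is
  -- selected together with its partner.
  S-small : 2 * ∣ S ∣ ≤ n
  S-small = begin
    2 * ∣ S ∣                   ≡⟨ cong (∣ S ∣ +_) (+-identityʳ ∣ S ∣) ⟩
    ∣ S ∣ + ∣ S ∣               ≡⟨ cong₂ _+_ count (trans count partners) ⟩
    sum χ + sum (χ ∘ f)         ≡⟨ ∑-distrib-+ χ (χ ∘ f) ⟨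
    sum (λ u → χ u + χ (f u))   ≤⟨ sum-mono-≤ disjoint ⟩
    sum {n} (λ _ → 1)           ≡⟨ sum-ones n ⟩
    n                           ∎
    where
    open ≤-Reasoning
    χ : Fin n → ℕ
    χ u = 𝟙 (selected? u)
    count : ∣ S ∣ ≡ sum χ
    count = ∣tabulate∣ (does ∘ selected?)
    partners : sum χ ≡ sum (χ ∘ f)
    partners = sum-permute χ (Perm.permutation f f ff ff)
    disjoint : ∀ u → χ u + χ (f u) ≤ 1
    disjoint u = 𝟙-disjoint (selected? u) (selected? (f u)) selected-partner

theorem1 : (n : ℕ) (G : Graph n) → TwinFree G → NoIsolated G →
    ∃[ D ] ∃[ S ] (IsOrientation G D × IsLocDom D S × 2 * ∣ S ∣ ≤ n)
theorem1 n G twin-free no-isolated with f , max ← Matchings.maximum-exists G =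
  D , S , D-orientation , D-locDom twin-free no-isolated , S-small
  where open Construction G f max
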